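{- A permutation in $\mathcal{A}_n$ lies in a geodesic of the graph $X_n$ between $e$ and $w_0$ if and only if it is unimodal.
   Context: An interval in $\mathbb{Z}$ is a set $[a,b]=\{a,\dots,b\}$; an interval in $\mathbb{Z}_n$ is a subset of $\{1,\dots,n\}$ of the form $[a,b]$ or $[b,n]\cup[1,a]$ with $1\le a\le b\le n$. A permutation $\pi\in\mathcal{S}_n$ is an arc permutation if for every $1\le j\le n$ the set $\{\pi(1),\dots,\pi(j)\}$ is an interval in $\mathbb{Z}_n$; $\mathcal{A}_n$ is the set of arc permutations. A permutation is unimodal if either every prefix set $\{\pi(1),\dots,\pi(j)\}$, $1\le j\le n$, or every suffix set $\{\pi(j),\dots,\pi(n)\}$, $1\le j\le n$, is an interval in $\mathbb{Z}$. $X_n$ is the graph with vertex set $\mathcal{A}_n$ in which $u,v$ are adjacent iff $u=v\sigma_i$ for some adjacent transposition $\sigma_i=(i,i+1)$, $1\le i\le n-1$ (i.e. $u$ is obtained from $v$ by exchanging the letters in positions $i$ and $i+1$). $e=12\cdots n$ and $w_0=n\cdots21$. A geodesic between two vertices is a shortest path between them, endpoints included. -}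

module Defs where

open import Level using (0ℓ)
open import Data.Nat.Base as ℕ using (ℕ; suc)
import Data.Nat.Properties as ℕₚ
open import Data.Fin.Base using (Fin; toℕ; fromℕ; opposite; _≤_)
open import Data.Fin.Properties
  using (≤fromℕ; opposite-prop; opposite-involutive)
open import Data.Fin.Permutation
  using (Permutation′; _⟨$⟩ʳ_; _≈_; _∘ₚ_; id; reverse; transpose)
open import Data.Product.Base using (∃; ∃₂; _×_; _,_; proj₁)
open import Data.Sum.Base using (_⊎_; inj₁)
open import Data.Unit.Base using (⊤)
open import Relation.Binary.Core using (Rel)
open import Relation.Binary.PropositionalEquality.Core
  using (_≡_; refl; sym; subst; subst₂)
open import Relation.Nullary.Negation.Core using (¬_)
open import Relation.Unary using (Pred; _≐_; _∪_)

-- Letters and positions 1, …, n are represented by the elements of Fin n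
-- (so they are shifted to 0, …, n - 1), and a permutation is read as the word
-- whose letter in position i is π ⟨$⟩ʳ i.

private
  variable
    n : ℕ

[_,_] : Fin n → Fin n → Pred (Fin n) 0ℓ
[ a , b ] k = a ≤ k × k ≤ b

[_,n] : Fin n → Pred (Fin n) 0ℓ
[ b ,n] k = b ≤ k

[1,_] : Fin n → Pred (Fin n) 0ℓ
[1, a ] k = k ≤ a

-- The endpoints of an interval belong to it, so for a set of letters they are
-- themselves letters.
IsIntervalInℤ : Pred (Fin n) 0ℓ → Set
IsIntervalInℤ S = ∃₂ λ a b → a ≤ b × S ≐ [ a , b ]

IsIntervalInℤₙ : Pred (Fin n) 0ℓ → Set
IsIntervalInℤₙ S =
  ∃₂ λ a b → a ≤ b × (S ≐ [ a , b ] ⊎ S ≐ ([ b ,n] ∪ [1, a ]))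

-- { π(1), …, π(j) }
PrefixSet : Permutation′ n → Fin n → Pred (Fin n) 0ℓ
PrefixSet π j k = ∃ λ i → i ≤ j × π ⟨$⟩ʳ i ≡ k

-- { π(j), …, π(n) }
SuffixSet : Permutation′ n → Fin n → Pred (Fin n) 0ℓ
SuffixSet π j k = ∃ λ i → j ≤ i × π ⟨$⟩ʳ i ≡ k

IsArc : Permutation′ n → Set
IsArc π = ∀ j → IsIntervalInℤₙ (PrefixSet π j)

IsUnimodal : Permutation′ n → Set
IsUnimodal π =
  (∀ j → IsIntervalInℤ (PrefixSet π j)) ⊎ (∀ j → IsIntervalInℤ (SuffixSet π j))

-- The vertex set of X n. Two vertices are the same when their underlying
-- permutations are equal as functions; the proof components are ignored.
𝒜 : ℕ → Set
𝒜 n = ∃ λ (π : Permutation′ n) → IsArc π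

infix 4 _≈ᵥ_ _∼_ _∈_

_≈ᵥ_ : Rel (𝒜 n) 0ℓ
u ≈ᵥ v = proj₁ u ≈ proj₁ v

-- Adjacency in X n: u = v σᵢ for some σᵢ = (i, i + 1). The product v σᵢ acts on
-- positions first, and _∘ₚ_ composes in diagrammatic order.
_∼_ : Rel (𝒜 n) 0ℓ
u ∼ v = ∃₂ λ i i⁺ →
  toℕ i⁺ ≡ suc (toℕ i) × proj₁ u ≈ (transpose i i⁺ ∘ₚ proj₁ v)

data Walk {n} : Rel (𝒜 n) 0ℓ where
  stop : ∀ {u v} → u ≈ᵥ v → Walk u v
  step : ∀ {u v w} → u ∼ v → Walk v w → Walk u w

length : {u v : 𝒜 n} → Walk u v → ℕ
length (stop _)   = 0
length (step _ p) = suc (length p)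

_∈_ : 𝒜 n → {u v : 𝒜 n} → Walk u v → Set
x ∈ stop {u} _   = x ≈ᵥ u
x ∈ step {u} _ p = x ≈ᵥ u ⊎ x ∈ p

IsPath : {u v : 𝒜 n} → Walk u v → Set
IsPath (stop _)       = ⊤
IsPath (step {u} _ p) = ¬ (u ∈ p) × IsPath p

IsGeodesic : {u v : 𝒜 n} → Walk u v → Set
IsGeodesic {u = u} {v} p =
  IsPath p × (∀ (q : Walk u v) → IsPath q → length p ℕ.≤ length q)

LiesInGeodesicBetween : 𝒜 n → 𝒜 n → 𝒜 n → Set
LiesInGeodesicBetween u v x = ∃ λ (p : Walk u v) → IsGeodesic p × x ∈ p

id-isArc : IsArc (id {n})
id-isArc {suc n} j =
  Fin.zero , j , ℕ.z≤n ,
  inj₁ ((λ { (i , i≤j , refl) → ℕ.z≤n , i≤j }) , λ { (_ , k≤j) → _ , k≤j , refl })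

opposite-anti-≤ : {i j : Fin n} → i ≤ j → opposite j ≤ opposite i
opposite-anti-≤ {n} {i} {j} i≤j =
  subst₂ ℕ._≤_ (sym (opposite-prop j)) (sym (opposite-prop i))
    (ℕₚ.∸-monoʳ-≤ n (ℕ.s≤s i≤j))

reverse-isArc : IsArc (reverse {n})
reverse-isArc {suc n} j =
  opposite j , fromℕ n , ≤fromℕ (opposite j) ,
  inj₁
    ( (λ { (i , i≤j , refl) → opposite-anti-≤ {i = i} {j} i≤j , ≤fromℕ (opposite i) })
    , λ {k} (j′≤k , _) →
        opposite k
        , subst (opposite k ≤_) (opposite-involutive j)
            (opposite-anti-≤ {i = opposite j} {k} j′≤k)
        , opposite-involutive k )

e : 𝒜 n
e = id , id-isArc

w₀ : 𝒜 n
w₀ = reverse , reverse-isArc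

-- The inversion number changes by one along every edge of X n, and some walk from
-- e to w₀ increases it at every step, so the geodesics from e to w₀ are exactly
-- the walks all of whose steps are ascents.
--
-- Every suffix set of π is an interval in ℤ iff no entry lies strictly between two
-- later ones, and exchanging the letters of the last descent preserves this
-- condition; so an ascending walk leads from e to π. Reversing positions or values
-- turns it into the other walks needed between e, π and w₀.
--
-- Conversely, an arc permutation whose first or last letter is 1 or n is unimodal.
-- Suppose neither letter of π is 1 or n. If 1 precedes n, then both properties
-- persist along ascents: 1 and n cannot be exchanged inside X n, and an ascent
-- bringing one of them to an end would need n to precede 1. So w₀ is not reached
-- from π. If n precedes 1, the same argument backwards shows that π is not reached
-- from e.
module Submission where

open import Defs
open import Data.Nat.Base as ℕ using (ℕ; zero; suc; z≤n; s≤s; s<s; s<s⁻¹)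
import Data.Nat.Properties as ℕₚ
open import Algebra.Properties.CommutativeSemigroup ℕₚ.+-commutativeSemigroup
  using (x∙yz≈y∙xz)
open import Data.Fin.Base
  using (Fin; zero; suc; toℕ; fromℕ; opposite; inject₁; lower₁; _≤_; _<_)
open import Data.Fin.Properties
  using (_≟_; _≤?_; any?; <-cmp; toℕ-injective; toℕ-fromℕ; toℕ-inject₁;
         toℕ-lower₁; toℕ<n; ≤fromℕ; ≤∧≢⇒<; opposite-prop; opposite-involutive)
open import Data.Fin.Permutation
  using (Permutation′; _⟨$⟩ʳ_; _⟨$⟩ˡ_; _≈_; _∘ₚ_; id; reverse; transpose;
         inverseˡ; inverseʳ)
import Data.Fin.Permutation.Components as PC
open import Data.Product.Base using (∃; ∃₂; _×_; _,_; proj₁; proj₂)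
open import Data.Sum.Base using (_⊎_; inj₁; inj₂; swap)
open import Data.Unit.Base using (⊤; tt)
open import Function.Base using (_∘_)
open import Function.Bundles using (_⇔_; mk⇔; Injection)
open import Function.Properties.Inverse using (↔⇒↣)
open import Level using (0ℓ)
open import Relation.Binary.Definitions using (tri<; tri≈; tri>)
open import Relation.Binary.PropositionalEquality.Core
  using (_≡_; _≢_; refl; sym; trans; cong; cong₂; subst; subst₂)
open import Relation.Binary.PropositionalEquality.Properties using (module ≡-Reasoning)
open import Relation.Nullary.Decidable using (Dec; yes; no; _×-dec_; _⊎-dec_; decidable-stable)
open import Relation.Nullary.Negation.Core using (¬_; contradiction)
open import Relation.Unary using (Pred; Decidable; _≐_; _∪_; ∁)
import Relation.Unary.Properties as Unary

private
  variable
    m n : ℕ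

-- Adjacent transpositions

⟨$⟩ʳ-injective : (π : Permutation′ n) {i j : Fin n} → π ⟨$⟩ʳ i ≡ π ⟨$⟩ʳ j → i ≡ j
⟨$⟩ʳ-injective π = Injection.injective (↔⇒↣ π)

infix 4 _⋖_

_⋖_ : Fin n → Fin n → Set
i ⋖ j = toℕ j ≡ suc (toℕ i)

⋖⇒< : {i j : Fin n} → i ⋖ j → i < j
⋖⇒< i⋖j = ℕₚ.≤-reflexive (sym i⋖j)

⋖⇒≢ : {i j : Fin n} → i ⋖ j → i ≢ j
⋖⇒≢ {i = i} i⋖j refl = ℕₚ.n≮n (toℕ i) (⋖⇒< {i = i} {i} i⋖j)

<-⋖ : {i j k : Fin n} → i ⋖ j → k < j → k ≢ i → k < i
<-⋖ {i = i} {k = k} i⋖j k<j k≢i =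
  ≤∧≢⇒< {i = k} {j = i} (ℕₚ.≤-pred (subst (suc (toℕ k) ℕ.≤_) i⋖j k<j)) k≢i

⋖-< : {i j k : Fin n} → i ⋖ j → i < k → k ≢ j → j < k
⋖-< {i = i} {j} {k} i⋖j i<k k≢j =
  ≤∧≢⇒< {i = j} {j = k} (subst (ℕ._≤ toℕ k) (sym i⋖j) i<k) (k≢j ∘ sym)

transpose-matchˡ : (i j : Fin n) → PC.transpose i j i ≡ j
transpose-matchˡ i j with i ≟ i
... | yes _  = refl
... | no i≢i = contradiction refl i≢i

transpose-matchʳ : (i j : Fin n) → PC.transpose i j j ≡ i
transpose-matchʳ i j with j ≟ i
... | yes j≡i = j≡i
... | no _ with j ≟ j
...   | yes _  = refl
...   | no j≢j = contradiction refl j≢j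

transpose-mismatch : {i j k : Fin n} → k ≢ i → k ≢ j → PC.transpose i j k ≡ k
transpose-mismatch {i = i} {j} {k} k≢i k≢j with k ≟ i
... | yes k≡i = contradiction k≡i k≢i
... | no _ with k ≟ j
...   | yes k≡j = contradiction k≡j k≢j
...   | no _    = refl

transpose-involutive : (i j k : Fin n) → PC.transpose i j (PC.transpose i j k) ≡ k
transpose-involutive i j k with k ≟ i
... | yes refl = transpose-matchʳ k j
... | no k≢i with k ≟ j
...   | yes refl = transpose-matchˡ i k
...   | no k≢j   = transpose-mismatch k≢i k≢j

-- No position lies strictly between `i` and `j`, so exchanging them can only invert the pair
-- `(i , j)` itself.
transpose-< : {i j a b : Fin n} → i ⋖ j → a < b →
  (a ≡ i × b ≡ j) ⊎ PC.transpose i j a < PC.transpose i j b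
transpose-< {i = i} {j} {a} {b} i⋖j a<b = cases (a ≟ i) (a ≟ j) (b ≟ i) (b ≟ j)
  where
  τ = PC.transpose i j
  i<j : i < j
  i<j = ⋖⇒< {i = i} {j} i⋖j
  cases : Dec (a ≡ i) → Dec (a ≡ j) → Dec (b ≡ i) → Dec (b ≡ j) →
    (a ≡ i × b ≡ j) ⊎ τ a < τ b
  cases (yes a≡i) _ _ (yes b≡j) = inj₁ (a≡i , b≡j)
  cases (yes refl) _ (yes refl) _ = contradiction a<b (ℕₚ.n≮n _)
  cases (yes refl) _ (no b≢i) (no b≢j) = inj₂ (subst₂ _<_
    (sym (transpose-matchˡ i j)) (sym (transpose-mismatch b≢i b≢j))
    (⋖-< {i = i} {j} {b} i⋖j a<b b≢j))
  cases (no _) (yes refl) (yes refl) _ = contradiction a<b (ℕₚ.<-asym i<j)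
  cases (no _) (yes refl) _ (yes refl) = contradiction a<b (ℕₚ.n≮n _)
  cases (no _) (yes refl) (no b≢i) (no b≢j) = inj₂ (subst₂ _<_
    (sym (transpose-matchʳ i j)) (sym (transpose-mismatch b≢i b≢j))
    (ℕₚ.<-trans i<j a<b))
  cases (no a≢i) (no a≢j) (yes refl) _ = inj₂ (subst₂ _<_
    (sym (transpose-mismatch a≢i a≢j)) (sym (transpose-matchˡ i j))
    (ℕₚ.<-trans a<b i<j))
  cases (no a≢i) (no a≢j) (no _) (yes refl) = inj₂ (subst₂ _<_
    (sym (transpose-mismatch a≢i a≢j)) (sym (transpose-matchʳ i j))
    (<-⋖ {i = i} {j} {a} i⋖j a<b a≢i))
  cases (no a≢i) (no a≢j) (no b≢i) (no b≢j) = inj₂ (subst₂ _<_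
    (sym (transpose-mismatch a≢i a≢j)) (sym (transpose-mismatch b≢i b≢j)) a<b)

-- A pointwise form of `g = f ∘ transpose i j` for functions into any type. Unlike a composite of
-- permutations it can be mapped to `ℕ` and restricted to a tail, as the induction on inversions
-- requires.
record Swapped {A : Set} (i j : Fin n) (f g : Fin n → A) : Set where
  constructor swapped
  field
    atˡ  : g i ≡ f j
    atʳ  : g j ≡ f i
    else : ∀ {k} → k ≢ i → k ≢ j → g k ≡ f k

open Swapped

module _ {A : Set} {i j : Fin n} {f g : Fin n → A} where

  transpose⇒Swapped : (∀ k → g k ≡ f (PC.transpose i j k)) → Swapped i j f g
  transpose⇒Swapped eq .atˡ          = trans (eq i) (cong f (transpose-matchˡ i j))
  transpose⇒Swapped eq .atʳ          = trans (eq j) (cong f (transpose-matchʳ i j))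
  transpose⇒Swapped eq .else k≢i k≢j = trans (eq _) (cong f (transpose-mismatch k≢i k≢j))

  Swapped⇒transpose : Swapped i j f g → ∀ k → g k ≡ f (PC.transpose i j k)
  Swapped⇒transpose s k with k ≟ i
  ... | yes refl = s .atˡ
  ... | no k≢i with k ≟ j
  ...   | yes refl = s .atʳ
  ...   | no k≢j   = s .else k≢i k≢j

  Swapped-sym : Swapped i j f g → Swapped i j g f
  Swapped-sym s .atˡ          = sym (s .atʳ)
  Swapped-sym s .atʳ          = sym (s .atˡ)
  Swapped-sym s .else k≢i k≢j = sym (s .else k≢i k≢j)

Swapped-map : {A B : Set} {i j : Fin n} {f g : Fin n → A} (h : A → B) →
  Swapped i j f g → Swapped i j (h ∘ f) (h ∘ g)
Swapped-map h s .atˡ          = cong h (s .atˡ)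
Swapped-map h s .atʳ          = cong h (s .atʳ)
Swapped-map h s .else k≢i k≢j = cong h (s .else k≢i k≢j)

Swapped-tail : {A : Set} {i j : Fin n} {f g : Fin (suc n) → A} →
  Swapped (suc i) (suc j) f g → Swapped i j (f ∘ suc) (g ∘ suc)
Swapped-tail s .atˡ = s .atˡ
Swapped-tail s .atʳ = s .atʳ
Swapped-tail s .else k≢i k≢j = s .else (k≢i ∘ λ { refl → refl }) (k≢j ∘ λ { refl → refl })

-- Ascents and inversions

-- The covering relation of the weak order on all permutations, with positions exchanged; arc
-- permutations enter only later.
Ascent : Permutation′ n → Permutation′ n → Set
Ascent π ρ =
  ∃₂ λ i j → i ⋖ j × π ⟨$⟩ʳ i < π ⟨$⟩ʳ j × Swapped i j (π ⟨$⟩ʳ_) (ρ ⟨$⟩ʳ_)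

𝟙[_<_] : ℕ → ℕ → ℕ
𝟙[ x < y ] with x ℕₚ.<? y
... | yes _ = 1
... | no  _ = 0

𝟙-< : ∀ {x y} → x ℕ.< y → 𝟙[ x < y ] ≡ 1
𝟙-< {x} {y} x<y with x ℕₚ.<? y
... | yes _  = refl
... | no x≮y = contradiction x<y x≮y

𝟙-≮ : ∀ {x y} → ¬ x ℕ.< y → 𝟙[ x < y ] ≡ 0
𝟙-≮ {x} {y} x≮y with x ℕₚ.<? y
... | yes x<y = contradiction x<y x≮y
... | no _    = refl

countBelow : ℕ → (Fin n → ℕ) → ℕ
countBelow {zero}  x f = 0
countBelow {suc n} x f = 𝟙[ f zero < x ] ℕ.+ countBelow x (f ∘ suc)

inversions : (Fin n → ℕ) → ℕ
inversions {zero}  f = 0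
inversions {suc n} f = countBelow (f zero) (f ∘ suc) ℕ.+ inversions (f ∘ suc)

countBelow-cong : ∀ x {f g : Fin n → ℕ} → (∀ k → f k ≡ g k) → countBelow x f ≡ countBelow x g
countBelow-cong {zero}  x eq = refl
countBelow-cong {suc n} x eq =
  cong₂ ℕ._+_ (cong 𝟙[_< x ] (eq zero)) (countBelow-cong x (eq ∘ suc))

inversions-cong : {f g : Fin n → ℕ} → (∀ k → f k ≡ g k) → inversions f ≡ inversions g
inversions-cong {zero}  eq = refl
inversions-cong {suc n} {f} {g} eq =
  cong₂ ℕ._+_
    (trans (cong (λ x → countBelow x (f ∘ suc)) (eq zero))
           (countBelow-cong (g zero) (eq ∘ suc)))
    (inversions-cong (eq ∘ suc))

countBelow-Swapped : ∀ x {i j} {f g : Fin n → ℕ} → i ⋖ j → Swapped i j f g →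
  countBelow x g ≡ countBelow x f
countBelow-Swapped x {zero} {suc zero} {f} {g} i⋖j s = trans
  (cong₂ ℕ._+_ (cong 𝟙[_< x ] (s .atˡ))
    (cong₂ ℕ._+_ (cong 𝟙[_< x ] (s .atʳ)) (countBelow-cong x (λ k → s .else {suc (suc k)} (λ ()) (λ ())))))
  (x∙yz≈y∙xz 𝟙[ f (suc zero) < x ] 𝟙[ f zero < x ] _)
countBelow-Swapped x {suc i} {suc j} i⋖j s =
  cong₂ ℕ._+_ (cong 𝟙[_< x ] (s .else (λ ()) (λ ())))
    (countBelow-Swapped x (ℕₚ.suc-injective i⋖j) (Swapped-tail s))

-- For a swap at the head, the counts of the two letters against the common rest trade places, and
-- the pair itself contributes 1 instead of 0. For a swap further on, the head is compared with the
-- same letters in another order.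
inversions-Swapped : ∀ {i j} {f g : Fin n → ℕ} → i ⋖ j → f i ℕ.< f j →
  Swapped i j f g → inversions g ≡ suc (inversions f)
inversions-Swapped {n = suc (suc n)} {i = zero} {suc zero} {f} {g} i⋖j f₀<f₁ s = begin
  (𝟙[ g₁ < g₀ ] ℕ.+ countBelow g₀ g″) ℕ.+ (countBelow g₁ g″ ℕ.+ inversions g″)
    ≡⟨ cong₂ ℕ._+_
         (cong₂ ℕ._+_ (trans (cong₂ 𝟙[_<_] (s .atʳ) (s .atˡ)) (𝟙-< f₀<f₁)) (count (s .atˡ)))
         (cong₂ ℕ._+_ (count (s .atʳ)) (inversions-cong g″≡f″)) ⟩
  suc (countBelow f₁ f″ ℕ.+ (countBelow f₀ f″ ℕ.+ inversions f″))
    ≡⟨ cong suc (x∙yz≈y∙xz (countBelow f₁ f″) (countBelow f₀ f″) _) ⟩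
  suc (countBelow f₀ f″ ℕ.+ (countBelow f₁ f″ ℕ.+ inversions f″))
    ≡⟨ cong (λ x → suc (x ℕ.+ countBelow f₀ f″ ℕ.+ (countBelow f₁ f″ ℕ.+ inversions f″))) (𝟙-≮ (ℕₚ.<⇒≯ f₀<f₁)) ⟨
  suc ((𝟙[ f₁ < f₀ ] ℕ.+ countBelow f₀ f″) ℕ.+ (countBelow f₁ f″ ℕ.+ inversions f″)) ∎
  where
  open ≡-Reasoning
  f₀ = f zero
  f₁ = f (suc zero)
  g₀ = g zero
  g₁ = g (suc zero)
  f″ g″ : Fin n → ℕ
  f″ k = f (suc (suc k))
  g″ k = g (suc (suc k))
  g″≡f″ : ∀ k → g″ k ≡ f″ k
  g″≡f″ k = s .else (λ ()) (λ ())
  count : ∀ {x y} → x ≡ y → countBelow x g″ ≡ countBelow y f″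
  count {x} refl = countBelow-cong x g″≡f″
inversions-Swapped {i = suc i} {suc j} {f} {g} i⋖j fi<fj s = trans
  (cong₂ ℕ._+_
    (trans (cong (λ x → countBelow x (g ∘ suc)) (s .else (λ ()) (λ ())))
           (countBelow-Swapped (f zero) (ℕₚ.suc-injective i⋖j) (Swapped-tail s)))
    (inversions-Swapped (ℕₚ.suc-injective i⋖j) fi<fj (Swapped-tail s)))
  (ℕₚ.+-suc _ _)

inv : Permutation′ n → ℕ
inv π = inversions (λ i → toℕ (π ⟨$⟩ʳ i))

inv-cong : (π ρ : Permutation′ n) → π ≈ ρ → inv π ≡ inv ρ
inv-cong _ _ π≈ρ = inversions-cong (cong toℕ ∘ π≈ρ)

inv-Ascent : (π ρ : Permutation′ n) → Ascent π ρ → inv ρ ≡ suc (inv π)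
inv-Ascent _ _ (i , j , i⋖j , πi<πj , s) = inversions-Swapped i⋖j πi<πj (Swapped-map toℕ s)

∼⇒Ascent : {u v : 𝒜 n} → u ∼ v → Ascent (proj₁ u) (proj₁ v) ⊎ Ascent (proj₁ v) (proj₁ u)
∼⇒Ascent {u = u , _} {v , _} (i , j , i⋖j , eq) with <-cmp (u ⟨$⟩ʳ i) (u ⟨$⟩ʳ j)
... | tri< ui<uj _ _ = inj₁ (i , j , i⋖j , ui<uj , Swapped-sym (transpose⇒Swapped eq))
... | tri≈ _ ui≡uj _ = contradiction (⟨$⟩ʳ-injective u ui≡uj) (⋖⇒≢ {i = i} i⋖j)
... | tri> _ _ uj<ui = inj₂ (i , j , i⋖j , subst₂ _<_ (s .atʳ) (s .atˡ) uj<ui , s)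
  where
  s : Swapped i j (v ⟨$⟩ʳ_) (u ⟨$⟩ʳ_)
  s = transpose⇒Swapped eq

Ascent⇒∼ : {u v : 𝒜 n} → Ascent (proj₁ u) (proj₁ v) → u ∼ v
Ascent⇒∼ (i , j , i⋖j , _ , s) = i , j , i⋖j , Swapped⇒transpose (Swapped-sym s)

-- Ascending walks and geodesics

Ascending : {u v : 𝒜 n} → Walk u v → Set
Ascending (stop _)           = ⊤
Ascending (step {u} {v} _ p) = Ascent (proj₁ u) (proj₁ v) × Ascending p

invᵥ : 𝒜 n → ℕ
invᵥ = inv ∘ proj₁

-- An edge raises `inv` by at most one. The next two lemmas identify the walks attaining this bound
-- as the ascending ones.
inv≤+length : {u v : 𝒜 n} (p : Walk u v) → invᵥ v ℕ.≤ invᵥ u ℕ.+ length p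
inv≤+length {u = u} {v} (stop u≈v) =
  ℕₚ.≤-reflexive (trans (sym (inv-cong (proj₁ u) (proj₁ v) u≈v)) (sym (ℕₚ.+-identityʳ _)))
inv≤+length {u = u} {w} (step {v = v} u∼v p) = begin
  invᵥ w                       ≤⟨ inv≤+length p ⟩
  invᵥ v ℕ.+ length p          ≤⟨ ℕₚ.+-monoˡ-≤ (length p) v≤1+u ⟩
  suc (invᵥ u) ℕ.+ length p    ≡⟨ ℕₚ.+-suc (invᵥ u) (length p) ⟨
  invᵥ u ℕ.+ suc (length p)    ∎
  where
  open ℕₚ.≤-Reasoning
  v≤1+u : invᵥ v ℕ.≤ suc (invᵥ u)
  v≤1+u with ∼⇒Ascent {u = u} {v} u∼v
  ... | inj₁ u<v = ℕₚ.≤-reflexive (inv-Ascent (proj₁ u) (proj₁ v) u<v)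
  ... | inj₂ v<u = ℕₚ.≤-trans (ℕₚ.n≤1+n _)
    (ℕₚ.≤-trans (ℕₚ.≤-reflexive (sym (inv-Ascent (proj₁ v) (proj₁ u) v<u))) (ℕₚ.n≤1+n _))

Ascending-inv : {u v : 𝒜 n} (p : Walk u v) → Ascending p → invᵥ v ≡ invᵥ u ℕ.+ length p
Ascending-inv {u = u} {v} (stop u≈v) _ =
  trans (sym (inv-cong (proj₁ u) (proj₁ v) u≈v)) (sym (ℕₚ.+-identityʳ _))
Ascending-inv {u = u} (step {v = v} _ p) (u<v , asc) =
  trans (Ascending-inv p asc)
    (trans (cong (ℕ._+ length p) (inv-Ascent (proj₁ u) (proj₁ v) u<v))
           (sym (ℕₚ.+-suc (invᵥ u) (length p))))

-- A descending step would leave a remainder that is too short for the inversions still to be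
-- gained, contrary to `inv≤+length`.
inv-Ascending : {u v : 𝒜 n} (p : Walk u v) → invᵥ u ℕ.+ length p ℕ.≤ invᵥ v → Ascending p
inv-Ascending (stop _) _ = tt
inv-Ascending {u = u} {w} (step {v = v} u∼v p) le with ∼⇒Ascent {u = u} {v} u∼v
... | inj₁ u<v = u<v , inv-Ascending p
  (ℕₚ.≤-trans (ℕₚ.≤-reflexive
    (trans (cong (ℕ._+ length p) (inv-Ascent (proj₁ u) (proj₁ v) u<v))
           (sym (ℕₚ.+-suc (invᵥ u) (length p))))) le)
... | inj₂ v<u = contradiction (inv≤+length p) (ℕₚ.<⇒≱ (begin-strict
  invᵥ v ℕ.+ length p          <⟨ ℕₚ.n<1+n _ ⟩
  suc (invᵥ v) ℕ.+ length p    ≡⟨ cong (ℕ._+ length p) (inv-Ascent (proj₁ v) (proj₁ u) v<u) ⟨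
  invᵥ u ℕ.+ length p          ≤⟨ ℕₚ.+-monoʳ-≤ (invᵥ u) (ℕₚ.n≤1+n _) ⟩
  invᵥ u ℕ.+ suc (length p)    ≤⟨ le ⟩
  invᵥ w                       ∎))
  where open ℕₚ.≤-Reasoning

Ascending-∈ : {u v x : 𝒜 n} (p : Walk u v) → Ascending p → x ∈ p → invᵥ u ℕ.≤ invᵥ x
Ascending-∈ {u = u} {x = x} (stop _) _ x≈u =
  ℕₚ.≤-reflexive (sym (inv-cong (proj₁ x) (proj₁ u) x≈u))
Ascending-∈ {u = u} {x = x} (step _ p) _ (inj₁ x≈u) =
  ℕₚ.≤-reflexive (sym (inv-cong (proj₁ x) (proj₁ u) x≈u))
Ascending-∈ {u = u} (step {v = v} _ p) (u<v , asc) (inj₂ x∈p) =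
  ℕₚ.≤-trans (ℕₚ.n≤1+n _)
    (ℕₚ.≤-trans (ℕₚ.≤-reflexive (sym (inv-Ascent (proj₁ u) (proj₁ v) u<v)))
      (Ascending-∈ p asc x∈p))

-- All vertices after the first have strictly more inversions, so none recurs.
Ascending⇒IsPath : {u v : 𝒜 n} (p : Walk u v) → Ascending p → IsPath p
Ascending⇒IsPath (stop _) _ = tt
Ascending⇒IsPath {u = u} (step {v = v} _ p) (u<v , asc) =
  (λ u∈p → ℕₚ.<⇒≱ (ℕₚ.≤-reflexive (sym (inv-Ascent (proj₁ u) (proj₁ v) u<v)))
                   (Ascending-∈ p asc u∈p)) ,
  Ascending⇒IsPath p asc

Ascending⇒IsGeodesic : {u v : 𝒜 n} (p : Walk u v) → Ascending p → IsGeodesic p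
Ascending⇒IsGeodesic {u = u} p asc =
  Ascending⇒IsPath p asc , λ q _ → ℕₚ.+-cancelˡ-≤ (invᵥ u) _ _
    (ℕₚ.≤-trans (ℕₚ.≤-reflexive (sym (Ascending-inv p asc))) (inv≤+length q))

-- The ascending walk `p` shows that the lower bound on lengths is attained; `q` is no longer than
-- `p`, so it attains the bound too.
IsGeodesic⇒Ascending : {u v : 𝒜 n} (p q : Walk u v) → Ascending p → IsGeodesic q → Ascending q
IsGeodesic⇒Ascending {u = u} p q asc (_ , minimal) = inv-Ascending q
  (ℕₚ.≤-trans (ℕₚ.+-monoʳ-≤ (invᵥ u) (minimal p (Ascending⇒IsPath p asc)))
    (ℕₚ.≤-reflexive (sym (Ascending-inv p asc))))

-- Chains of ascents

-- `P` stands in for membership in `X n`: it will be one of the two interval conditions, each of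
-- which implies `IsArc` and behaves well under the symmetries. `P` is recorded for every
-- permutation except the starting one.
data Chain (P : Permutation′ n → Set) : Permutation′ n → Permutation′ n → Set where
  stop : ∀ {π ρ} → π ≈ ρ → Chain P π ρ
  step : ∀ {π ρ σ} → Ascent π ρ → P ρ → Chain P ρ σ → Chain P π σ

Ascent-respˡ : (π ρ σ : Permutation′ n) → π ≈ ρ → Ascent ρ σ → Ascent π σ
Ascent-respˡ _ _ _ π≈ρ (i , j , i⋖j , ρi<ρj , s) =
  i , j , i⋖j , subst₂ _<_ (sym (π≈ρ i)) (sym (π≈ρ j)) ρi<ρj ,
  swapped (trans (s .atˡ) (sym (π≈ρ j))) (trans (s .atʳ) (sym (π≈ρ i)))
    (λ {k} k≢i k≢j → trans (s .else k≢i k≢j) (sym (π≈ρ k)))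

module _ {P : Permutation′ n → Set} where

  Chain-resp : {π π′ ρ ρ′ : Permutation′ n} → π ≈ π′ → ρ ≈ ρ′ → Chain P π ρ → Chain P π′ ρ′
  Chain-resp π≈π′ ρ≈ρ′ (stop π≈ρ) =
    stop λ i → trans (sym (π≈π′ i)) (trans (π≈ρ i) (ρ≈ρ′ i))
  Chain-resp {π} {π′} π≈π′ ρ≈ρ′ (step {ρ = σ} asc Pσ c) =
    step (Ascent-respˡ π′ π σ (sym ∘ π≈π′) asc) Pσ (Chain-resp (λ _ → refl) ρ≈ρ′ c)

  snoc : {π ρ σ : Permutation′ n} → Chain P π ρ → Ascent ρ σ → P σ → Chain P π σ
  snoc {π} {ρ} {σ} (stop π≈ρ) asc Pσ =
    step (Ascent-respˡ π ρ σ π≈ρ asc) Pσ (stop λ _ → refl)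
  snoc (step asc′ Pρ c) asc Pσ = step asc′ Pρ (snoc c asc Pσ)

  walk : (P⇒arc : ∀ π → P π → IsArc π) {u v : 𝒜 n} →
    Chain P (proj₁ u) (proj₁ v) → ∃ λ (p : Walk u v) → Ascending p
  walk P⇒arc (stop u≈v) = stop u≈v , tt
  walk P⇒arc {u} {v} (step {ρ = ρ} asc Pρ c) =
    let (p , ascs) = walk P⇒arc {ρ , P⇒arc ρ Pρ} {v} c
    in step (Ascent⇒∼ {u = u} {ρ , P⇒arc ρ Pρ} asc) p , asc , ascs

-- The start of the given chain becomes the end of the new one, where `Q` has to be recorded; hence
-- the separate argument `P π`.
Chain-anti : {P Q : Permutation′ n → Set} (h : Permutation′ n → Permutation′ n) →
  (∀ π ρ → Ascent π ρ → Ascent (h ρ) (h π)) → (∀ π ρ → π ≈ ρ → h π ≈ h ρ) →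
  (∀ π → P π → Q (h π)) →
  ∀ {π ρ} → P π → Chain P π ρ → Chain Q (h ρ) (h π)
Chain-anti h anti resp P⇒Q {π} {ρ} Pπ (stop π≈ρ) = stop (sym ∘ resp π ρ π≈ρ)
Chain-anti h anti resp P⇒Q {π} Pπ (step {ρ = σ} asc Pσ c) =
  snoc (Chain-anti h anti resp P⇒Q Pσ c) (anti π σ asc) (P⇒Q π Pπ)

-- Symmetries of the weak order and the two interval conditions

opposite-injective : {i j : Fin n} → opposite i ≡ opposite j → i ≡ j
opposite-injective {i = i} {j} eq =
  trans (sym (opposite-involutive i)) (trans (cong opposite eq) (opposite-involutive j))

opposite-anti-< : {i j : Fin n} → i < j → opposite j < opposite i
opposite-anti-< {i = i} {j} i<j = ≤∧≢⇒< {i = opposite j} {opposite i}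
  (opposite-anti-≤ {i = i} {j} (ℕₚ.<⇒≤ i<j))
  (λ eq → ℕₚ.<⇒≢ i<j (cong toℕ (sym (opposite-injective eq))))

opposite-anti-⋖ : {i j : Fin n} → i ⋖ j → opposite j ⋖ opposite i
opposite-anti-⋖ {n} {i} {j} i⋖j = begin
  toℕ (opposite i)             ≡⟨ opposite-prop i ⟩
  n ℕ.∸ suc (toℕ i)            ≡⟨ cong (n ℕ.∸_) i⋖j ⟨
  n ℕ.∸ toℕ j                  ≡⟨ ℕₚ.+-∸-assoc 1 (toℕ<n j) ⟩
  suc (n ℕ.∸ suc (toℕ j))      ≡⟨ cong suc (opposite-prop j) ⟨
  suc (toℕ (opposite j))       ∎
  where open ≡-Reasoning

-- Complementing letters keeps the exchanged positions and inverts the comparison, whereas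
-- `reverse-anti` mirrors the positions. Both maps reverse the weak order and exchange `id` with
-- `reverse`.
complement-anti : (π ρ : Permutation′ n) → Ascent π ρ → Ascent (ρ ∘ₚ reverse) (π ∘ₚ reverse)
complement-anti π ρ (i , j , i⋖j , πi<πj , s) =
  i , j , i⋖j ,
  opposite-anti-< {i = ρ ⟨$⟩ʳ j} {ρ ⟨$⟩ʳ i} (subst₂ _<_ (sym (s .atʳ)) (sym (s .atˡ)) πi<πj) ,
  Swapped-sym (Swapped-map opposite s)

reverse-anti : (π ρ : Permutation′ n) → Ascent π ρ → Ascent (reverse ∘ₚ ρ) (reverse ∘ₚ π)
reverse-anti π ρ (i , j , i⋖j , πi<πj , s) =
  opposite j , opposite i , opposite-anti-⋖ {i = i} i⋖j ,
  subst₂ _<_ (sym (trans (at ρ j) (s .atʳ))) (sym (trans (at ρ i) (s .atˡ))) πi<πj ,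
  swapped (trans (at π j) (trans (sym (s .atˡ)) (sym (at ρ i))))
          (trans (at π i) (trans (sym (s .atʳ)) (sym (at ρ j))))
          (λ k≢j′ k≢i′ → sym (s .else (k≢i′ ∘ swap-opposite) (k≢j′ ∘ swap-opposite)))
  where
  at : ∀ (σ : Permutation′ _) k → σ ⟨$⟩ʳ opposite (opposite k) ≡ σ ⟨$⟩ʳ k
  at σ k = cong (σ ⟨$⟩ʳ_) (opposite-involutive k)
  swap-opposite : ∀ {k l : Fin _} → opposite k ≡ l → k ≡ opposite l
  swap-opposite {k} refl = sym (opposite-involutive k)

-- Equivalently, every suffix set is an interval in ℤ.
NoMiddleFirst : Permutation′ n → Set
NoMiddleFirst π = ∀ k i j → k < i → k < j → π ⟨$⟩ʳ i < π ⟨$⟩ʳ k → ¬ (π ⟨$⟩ʳ k < π ⟨$⟩ʳ j)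

-- No entry lies strictly between two earlier ones, the prefix form of unimodality. Defining it
-- through `reverse` lets it inherit the results on `NoMiddleFirst`.
NoMiddleLast : Permutation′ n → Set
NoMiddleLast π = NoMiddleFirst (reverse ∘ₚ π)

NoMiddleFirst-resp : (π ρ : Permutation′ n) → π ≈ ρ → NoMiddleFirst π → NoMiddleFirst ρ
NoMiddleFirst-resp _ _ π≈ρ noMid k i j k<i k<j ρi<ρk ρk<ρj =
  noMid k i j k<i k<j (subst₂ _<_ (sym (π≈ρ i)) (sym (π≈ρ k)) ρi<ρk)
              (subst₂ _<_ (sym (π≈ρ k)) (sym (π≈ρ j)) ρk<ρj)

NoMiddleFirst-id : NoMiddleFirst (id {n})
NoMiddleFirst-id _ _ _ k<i _ i<k _ = ℕₚ.<-asym k<i i<k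

-- A letter between two others stays between them under complementation; only the roles of the outer
-- two are exchanged.
NoMiddleFirst-complement : (π : Permutation′ n) →
  NoMiddleFirst π → NoMiddleFirst (π ∘ₚ reverse)
NoMiddleFirst-complement π noMid k i j k<i k<j lt gt =
  noMid k j i k<j k<i (cancel {π ⟨$⟩ʳ j} {π ⟨$⟩ʳ k} gt) (cancel {π ⟨$⟩ʳ k} {π ⟨$⟩ʳ i} lt)
  where
  cancel : ∀ {a b : Fin _} → opposite b < opposite a → a < b
  cancel {a} {b} lt = subst₂ _<_ (opposite-involutive a) (opposite-involutive b)
    (opposite-anti-< {i = opposite b} {opposite a} lt)

-- Removal of the last descent and chains from the identity

lastDescent : (f : Fin n → ℕ) → (∀ {i j} → f i ≡ f j → i ≡ j) →
  (∀ {i j} → i < j → f i ℕ.< f j) ⊎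
  (∃₂ λ i j → i ⋖ j × f j ℕ.< f i × (∀ k → j < k → f j ℕ.< f k))
lastDescent {zero} f inj = inj₁ λ { {()} }
lastDescent {suc zero} f inj = inj₁ λ { {zero} {zero} () }
lastDescent {suc (suc n)} f inj
  with lastDescent (f ∘ suc) (λ eq → toℕ-injective (ℕₚ.suc-injective (cong toℕ (inj eq))))
... | inj₂ (i , j , i⋖j , fj<fi , min) =
  inj₂ (suc i , suc j , cong suc i⋖j , fj<fi , λ { (suc k) j<k → min k (s<s⁻¹ j<k) })
-- The tail increases, so a descent at the head is the last one, and its smaller letter is below
-- everything after it.
... | inj₁ incr with ℕₚ.<-cmp (f zero) (f (suc zero))
...   | tri< f₀<f₁ _ _ = inj₁ λ
  { {zero}  {suc zero}    _   → f₀<f₁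
  ; {zero}  {suc (suc j)} _   → ℕₚ.<-trans f₀<f₁ (incr {zero} {suc j} (s≤s z≤n))
  ; {suc i} {suc j}       i<j → incr {i} {j} (s<s⁻¹ i<j)
  }
...   | tri≈ _ f₀≡f₁ _ = contradiction (inj f₀≡f₁) λ ()
...   | tri> _ _ f₁<f₀ = inj₂ (zero , suc zero , refl , f₁<f₀ , λ { (suc k) 0<k → incr {zero} {k} (s<s⁻¹ 0<k) })

-- The lower bound `m` is general for the induction: passing to the tail lowers the position by one
-- and raises the bound by one.
increasing⇒≥ : (f : Fin n → ℕ) → (∀ {i j} → i < j → f i ℕ.< f j) →
  ∀ m → (∀ i → m ℕ.≤ f i) → ∀ i → m ℕ.+ toℕ i ℕ.≤ f i
increasing⇒≥ f incr m m≤f zero    = subst (ℕ._≤ f zero) (sym (ℕₚ.+-identityʳ m)) (m≤f zero)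
increasing⇒≥ f incr m m≤f (suc i) = subst (ℕ._≤ f (suc i)) (sym (ℕₚ.+-suc m (toℕ i)))
  (increasing⇒≥ (f ∘ suc) (λ i<j → incr (s<s i<j)) (suc m)
    (λ k → ℕₚ.≤-<-trans (m≤f zero) (incr (s≤s z≤n))) i)

-- The inverse of `π` increases as well, so `increasing⇒≥` applied to both gives the two
-- inequalities.
increasing⇒≈id : (π : Permutation′ n) → (∀ {i j} → i < j → π ⟨$⟩ʳ i < π ⟨$⟩ʳ j) → id ≈ π
increasing⇒≈id π incr i = toℕ-injective (ℕₚ.≤-antisym
  (increasing⇒≥ (λ k → toℕ (π ⟨$⟩ʳ k)) (λ {i} {j} → incr {i} {j}) 0 (λ _ → z≤n) i)
  (subst (λ k → toℕ (π ⟨$⟩ʳ i) ℕ.≤ toℕ k) (inverseˡ π)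
    (increasing⇒≥ (λ k → toℕ (π ⟨$⟩ˡ k)) (λ {i} {j} → incr⁻¹ {i} {j}) 0 (λ _ → z≤n) (π ⟨$⟩ʳ i))))
  where
  incr⁻¹ : ∀ {a b} → a < b → π ⟨$⟩ˡ a < π ⟨$⟩ˡ b
  incr⁻¹ {a} {b} a<b with <-cmp (π ⟨$⟩ˡ a) (π ⟨$⟩ˡ b)
  ... | tri< lt _ _ = lt
  ... | tri≈ _ eq _ = contradiction
    (cong toℕ (trans (sym (inverseʳ π)) (trans (cong (π ⟨$⟩ʳ_) eq) (inverseʳ π)))) (ℕₚ.<⇒≢ a<b)
  ... | tri> _ _ gt = contradiction a<b
    (ℕₚ.<-asym (subst₂ _<_ (inverseʳ π) (inverseʳ π) (incr {π ⟨$⟩ˡ b} {π ⟨$⟩ˡ a} gt)))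

-- If k < i and k < j but the swap reverses one of these pairs, then that pair
-- is the descent itself, and minimality of its smaller entry is contradicted.
NoMiddleFirst-removeDescent : (π : Permutation′ n) {d d⁺ : Fin n} → d ⋖ d⁺ →
  π ⟨$⟩ʳ d⁺ < π ⟨$⟩ʳ d → (∀ k → d⁺ < k → π ⟨$⟩ʳ d⁺ < π ⟨$⟩ʳ k) →
  NoMiddleFirst π → NoMiddleFirst (transpose d d⁺ ∘ₚ π)
NoMiddleFirst-removeDescent π {d} {d⁺} d⋖d⁺ desc min noMid k i j k<i k<j lt gt
  with transpose-< {a = k} {i} d⋖d⁺ k<i | transpose-< {a = k} {j} d⋖d⁺ k<j
... | inj₂ τk<τi | inj₂ τk<τj =
  noMid (PC.transpose d d⁺ k) (PC.transpose d d⁺ i) (PC.transpose d d⁺ j) τk<τi τk<τj lt gt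
... | inj₁ (refl , refl) | _ =
  ℕₚ.<-asym desc (subst₂ (λ x y → π ⟨$⟩ʳ x < π ⟨$⟩ʳ y)
    (transpose-matchʳ k i) (transpose-matchˡ k i) lt)
... | inj₂ _ | inj₁ (refl , refl) with i ≟ j
...   | yes refl = ℕₚ.<-asym lt gt
...   | no i≢j   = ℕₚ.<-asym (min i (⋖-< {i = k} {j} {i} d⋖d⁺ k<i i≢j))
  (subst₂ (λ x y → π ⟨$⟩ʳ x < π ⟨$⟩ʳ y)
    (transpose-mismatch (λ { refl → ℕₚ.n≮n _ k<i }) i≢j) (transpose-matchˡ k j) lt)

-- Last descents are removed until none is left, by induction on the number of inversions. Each
-- removal, read backwards, is the final ascent of the chain built so far.
chain-from-id : (π : Permutation′ n) → NoMiddleFirst π → Chain NoMiddleFirst id π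
chain-from-id {n} π = go (inv π) π refl
  where
  go : ∀ m (π : Permutation′ n) → inv π ≡ m → NoMiddleFirst π → Chain NoMiddleFirst id π
  go m π eq noMid
    with lastDescent (λ k → toℕ (π ⟨$⟩ʳ k)) (λ eq′ → ⟨$⟩ʳ-injective π (toℕ-injective eq′))
  ... | inj₁ incr = stop (increasing⇒≈id π (λ {i} {j} → incr {i} {j}))
  ... | inj₂ (i , j , i⋖j , πj<πi , min) = descend m eq
    where
    π′ = transpose i j ∘ₚ π
    s : Swapped i j (π ⟨$⟩ʳ_) (π′ ⟨$⟩ʳ_)
    s = transpose⇒Swapped (λ _ → refl)
    asc : Ascent π′ π
    asc = i , j , i⋖j , subst₂ _<_ (sym (s .atˡ)) (sym (s .atʳ)) πj<πi , Swapped-sym s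
    descend : ∀ m → inv π ≡ m → Chain NoMiddleFirst id π
    -- `π` is the upper end of an ascent and so has an inversion.
    descend zero    eq = contradiction (trans (sym eq) (inv-Ascent π′ π asc)) λ ()
    descend (suc m) eq = snoc
      (go m π′ (ℕₚ.suc-injective (trans (sym (inv-Ascent π′ π asc)) eq))
        (NoMiddleFirst-removeDescent π i⋖j πj<πi min noMid))
      asc noMid

-- Complementation turns a chain from `id` to the complement of `π` into one from `π` to `reverse`.
chain-to-w₀ : (π : Permutation′ n) → NoMiddleFirst π → Chain NoMiddleFirst π reverse
chain-to-w₀ π noMid =
  Chain-resp (λ i → opposite-involutive (π ⟨$⟩ʳ i)) (λ _ → refl)
    (Chain-anti (_∘ₚ reverse) complement-anti (λ _ _ π≈ρ → cong opposite ∘ π≈ρ)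
      NoMiddleFirst-complement
      NoMiddleFirst-id
      (chain-from-id (π ∘ₚ reverse) (NoMiddleFirst-complement π noMid)))

-- Convex sets, intervals and arc permutations

Convex : Pred (Fin n) 0ℓ → Set
Convex S = ∀ {a b c} → a ≤ b → b ≤ c → S a → S c → S b

least : {S : Pred (Fin n) 0ℓ} → Decidable S → ∃ S → ∃ λ a → S a × (∀ {k} → S k → a ≤ k)
least {suc n} {S} S? (x , Sx) with S? zero
... | yes S₀ = zero , S₀ , λ _ → z≤n
... | no ¬S₀ with least (S? ∘ suc) (tail x Sx)
  where
  tail : ∀ x → S x → ∃ (S ∘ suc)
  tail zero    S₀ = contradiction S₀ ¬S₀
  tail (suc x) Sx = x , Sx
...   | a , Sa , min = suc a , Sa , λ { {zero} S₀ → contradiction S₀ ¬S₀ ; {suc k} Sk → s≤s (min Sk) }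

greatest : {S : Pred (Fin n) 0ℓ} → Decidable S → ∃ S → ∃ λ b → S b × (∀ {k} → S k → k ≤ b)
greatest {suc n} {S} S? (x , Sx) with any? (S? ∘ suc)
... | yes ∃S with greatest (S? ∘ suc) ∃S
...   | b , Sb , max = suc b , Sb , λ { {zero} _ → z≤n ; {suc k} Sk → s≤s (max Sk) }
greatest {suc n} {S} S? (zero , S₀)   | no ∄S =
  zero , S₀ , λ { {zero} _ → z≤n ; {suc k} Sk → contradiction (k , Sk) ∄S }
greatest {suc n} {S} S? (suc x , Sx)  | no ∄S = contradiction (x , Sx) ∄S

convex⇒interval : {S : Pred (Fin n) 0ℓ} → Decidable S → ∃ S → Convex S → IsIntervalInℤ S
convex⇒interval S? ∃S convex =
  let (a , Sa , min) = least S? ∃S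
      (b , Sb , max) = greatest S? ∃S
  in a , b , min Sb , (λ Sk → min Sk , max Sk) , λ (a≤k , k≤b) → convex a≤k k≤b Sa Sb

interval⇒intervalₙ : {S : Pred (Fin n) 0ℓ} → IsIntervalInℤ S → IsIntervalInℤₙ S
interval⇒intervalₙ (a , b , a≤b , eq) = a , b , a≤b , inj₁ eq

-- If `S` misses the least letter it is a final segment, and if it misses the greatest an initial
-- one. Otherwise its complement is empty or an interval containing neither extreme letter, and in
-- the latter case `S` wraps around it.
coconvex⇒intervalₙ : {S : Pred (Fin n) 0ℓ} → Decidable S → ∃ S → Convex (∁ S) → IsIntervalInℤₙ S
coconvex⇒intervalₙ {suc n} {S} S? ∃S convex
  with S? zero | S? (fromℕ n) | any? (Unary.∁? S?)
... | no ¬S₀ | _ | _ = interval⇒intervalₙ (convex⇒interval S? ∃S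
  λ {_} {b} a≤b _ Sa _ → decidable-stable (S? b) λ ¬Sb → convex z≤n a≤b ¬S₀ ¬Sb Sa)
... | yes _ | no ¬Sₙ | _ = interval⇒intervalₙ (convex⇒interval S? ∃S
  λ {_} {b} {c} _ b≤c _ Sc → decidable-stable (S? b) λ ¬Sb →
    convex b≤c (≤fromℕ c) ¬Sb ¬Sₙ Sc)
... | yes _ | yes _ | no ∄¬S = interval⇒intervalₙ (convex⇒interval S? ∃S
  λ {_} {b} _ _ _ _ → decidable-stable (S? b) λ ¬Sb → ∄¬S (b , ¬Sb))
... | yes S₀ | yes Sₙ | yes ∃¬S with convex⇒interval (Unary.∁? S?) ∃¬S convex
...   | zero , b , a≤b , _ , ⇒¬S = contradiction S₀ (⇒¬S (z≤n , z≤n))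
...   | suc a , b , a<b , ¬S⇒ , ⇒¬S =
  -- The complement is `[ suc a , b ]`, so `S` resumes at `b + 1`. This is a letter because `b`
  -- differs from the greatest letter, which lies in `S`.
  inject₁ a , suc (lower₁ b n≢b) ,
  subst₂ ℕ._≤_ (sym (toℕ-inject₁ a)) (sym b⁺) (ℕₚ.≤-trans (ℕₚ.n≤1+n _) (ℕₚ.m≤n⇒m≤1+n a<b)) ,
  inj₂ (to , from)
  where
  n≢b : n ≢ toℕ b
  n≢b n≡b = ⇒¬S {fromℕ n}
    (ℕₚ.≤-trans a<b (≤fromℕ b) , ℕₚ.≤-reflexive (trans (toℕ-fromℕ n) n≡b)) Sₙ
  b⁺ : toℕ (suc (lower₁ b n≢b)) ≡ suc (toℕ b)
  b⁺ = cong suc (toℕ-lower₁ b n≢b)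
  to : ∀ {k} → S k → ([ suc (lower₁ b n≢b) ,n] ∪ [1, inject₁ a ]) k
  to {k} Sk with toℕ k ℕₚ.≤? toℕ a
  ... | yes k≤a = inj₂ (subst (toℕ k ℕ.≤_) (sym (toℕ-inject₁ a)) k≤a)
  ... | no k≰a  = inj₁ (subst (ℕ._≤ toℕ k) (sym b⁺)
    (ℕₚ.≰⇒> λ k≤b → ⇒¬S (ℕₚ.≰⇒> k≰a , k≤b) Sk))
  from : ∀ {k} → ([ suc (lower₁ b n≢b) ,n] ∪ [1, inject₁ a ]) k → S k
  from {k} (inj₁ b<k) = decidable-stable (S? k) λ ¬Sk →
    ℕₚ.<⇒≱ (subst (ℕ._≤ toℕ k) b⁺ b<k) (proj₂ (¬S⇒ ¬Sk))
  from {k} (inj₂ k≤a) = decidable-stable (S? k) λ ¬Sk →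
    ℕₚ.<⇒≱ (proj₁ (¬S⇒ ¬Sk)) (subst (toℕ k ℕ.≤_) (toℕ-inject₁ a) k≤a)

IsIntervalInℤ-resp : {S T : Pred (Fin n) 0ℓ} → S ≐ T → IsIntervalInℤ S → IsIntervalInℤ T
IsIntervalInℤ-resp (S⊆T , T⊆S) (a , b , a≤b , to , from) =
  a , b , a≤b , to ∘ T⊆S , S⊆T ∘ from

module _ (π : Permutation′ n) where

  PrefixSet? : ∀ j → Decidable (PrefixSet π j)
  PrefixSet? j k = any? λ i → (i ≤? j) ×-dec (π ⟨$⟩ʳ i ≟ k)

  SuffixSet? : ∀ j → Decidable (SuffixSet π j)
  SuffixSet? j k = any? λ i → (j ≤? i) ×-dec (π ⟨$⟩ʳ i ≟ k)

  ∉PrefixSet : ∀ {i j} → j < i → ¬ PrefixSet π j (π ⟨$⟩ʳ i)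
  ∉PrefixSet j<i (i′ , i′≤j , eq) with ⟨$⟩ʳ-injective π eq
  ... | refl = ℕₚ.<⇒≱ j<i i′≤j

  ∉SuffixSet : ∀ {i j} → i < j → ¬ SuffixSet π j (π ⟨$⟩ʳ i)
  ∉SuffixSet i<j (i′ , j≤i′ , eq) with ⟨$⟩ʳ-injective π eq
  ... | refl = ℕₚ.<⇒≱ i<j j≤i′

  ≤⇒< : ∀ {a b i k} → a ≤ b → π ⟨$⟩ʳ i ≡ a → π ⟨$⟩ʳ k ≡ b → i ≢ k → π ⟨$⟩ʳ i < π ⟨$⟩ʳ k
  ≤⇒< {i = i} {k} a≤b refl refl i≢k =
    ≤∧≢⇒< {i = π ⟨$⟩ʳ i} {π ⟨$⟩ʳ k} a≤b (i≢k ∘ ⟨$⟩ʳ-injective π)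

  -- A letter `b` missing from the suffix occurs before it, hence before both `a` and `c`.
  SuffixSet-convex : NoMiddleFirst π → ∀ j → Convex (SuffixSet π j)
  SuffixSet-convex noMid j {a} {b} {c} a≤b b≤c (i , j≤i , πi≡a) (l , j≤l , πl≡c) =
    decidable-stable (SuffixSet? j b) λ b∉ →
      let k = π ⟨$⟩ˡ b
          k<j : k < j
          k<j = ℕₚ.≰⇒> λ j≤k → b∉ (k , j≤k , inverseʳ π)
          k<i = ℕₚ.<-≤-trans k<j j≤i
          k<l = ℕₚ.<-≤-trans k<j j≤l
      in noMid k i l k<i k<l
           (≤⇒< a≤b πi≡a (inverseʳ π) λ { refl → ℕₚ.n≮n _ k<i })
           (≤⇒< b≤c (inverseʳ π) πl≡c λ { refl → ℕₚ.n≮n _ k<l })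

  -- The complement consists of the letters after `j`. It is empty when `j` is the last position,
  -- and then it is not a suffix set.
  ∁PrefixSet-convex : NoMiddleFirst π → ∀ j → Convex (∁ (PrefixSet π j))
  ∁PrefixSet-convex noMid j {a} {b} {c} a≤b b≤c a∉ c∉ (k , k≤j , πk≡b) =
    noMid k (π ⟨$⟩ˡ a) (π ⟨$⟩ˡ c) (k< a∉) (k< c∉)
      (≤⇒< a≤b (inverseʳ π) πk≡b λ { refl → ℕₚ.n≮n _ (k< a∉) })
      (≤⇒< b≤c πk≡b (inverseʳ π) λ { refl → ℕₚ.n≮n _ (k< c∉) })
    where
    k< : ∀ {d} → ¬ PrefixSet π j d → k < π ⟨$⟩ˡ d
    k< d∉ = ℕₚ.≤-<-trans k≤j (ℕₚ.≰⇒> λ le → d∉ (_ , le , inverseʳ π))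

  NoMiddleFirst⇒suffixes : NoMiddleFirst π → ∀ j → IsIntervalInℤ (SuffixSet π j)
  NoMiddleFirst⇒suffixes noMid j = convex⇒interval (SuffixSet? j)
    (_ , j , ℕₚ.≤-refl , refl) (SuffixSet-convex noMid j)

  -- The suffix starting at the earlier of `i` and `j` contains both letters, hence the one between
  -- them, although `k` precedes it.
  suffixes⇒NoMiddleFirst : (∀ j → IsIntervalInℤ (SuffixSet π j)) → NoMiddleFirst π
  suffixes⇒NoMiddleFirst intervals k i j k<i k<j πi<πk πk<πj
    with ℕₚ.≤-total (toℕ i) (toℕ j)
  ... | inj₁ i≤j = let (a , b , _ , to , from) = intervals i in
    ∉SuffixSet k<i (from ( ℕₚ.≤-trans (proj₁ (to (i , ℕₚ.≤-refl , refl))) (ℕₚ.<⇒≤ πi<πk)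
                         , ℕₚ.≤-trans (ℕₚ.<⇒≤ πk<πj) (proj₂ (to (j , i≤j , refl)))))
  ... | inj₂ j≤i = let (a , b , _ , to , from) = intervals j in
    ∉SuffixSet k<j (from ( ℕₚ.≤-trans (proj₁ (to (i , j≤i , refl))) (ℕₚ.<⇒≤ πi<πk)
                         , ℕₚ.≤-trans (ℕₚ.<⇒≤ πk<πj) (proj₂ (to (j , ℕₚ.≤-refl , refl)))))

  NoMiddleFirst⇒IsArc : NoMiddleFirst π → IsArc π
  NoMiddleFirst⇒IsArc noMid j = coconvex⇒intervalₙ (PrefixSet? j)
    (_ , j , ℕₚ.≤-refl , refl) (∁PrefixSet-convex noMid j)

  PrefixSet≐SuffixSet-reverse : ∀ j → PrefixSet π j ≐ SuffixSet (reverse ∘ₚ π) (opposite j)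
  PrefixSet≐SuffixSet-reverse j =
    (λ (i , i≤j , eq) → opposite i , opposite-anti-≤ {i = i} {j} i≤j ,
      trans (cong (π ⟨$⟩ʳ_) (opposite-involutive i)) eq) ,
    (λ (i , j′≤i , eq) → opposite i ,
      subst (opposite i ≤_) (opposite-involutive j) (opposite-anti-≤ {i = opposite j} {i} j′≤i) ,
      eq)

NoMiddleLast⇒prefixes : (π : Permutation′ n) →
  NoMiddleLast π → ∀ j → IsIntervalInℤ (PrefixSet π j)
NoMiddleLast⇒prefixes π noMid j =
  let (to , from) = PrefixSet≐SuffixSet-reverse π j in
  IsIntervalInℤ-resp (from , to) (NoMiddleFirst⇒suffixes (reverse ∘ₚ π) noMid (opposite j))

prefixes⇒NoMiddleLast : (π : Permutation′ n) →
  (∀ j → IsIntervalInℤ (PrefixSet π j)) → NoMiddleLast π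
prefixes⇒NoMiddleLast π intervals = suffixes⇒NoMiddleFirst (reverse ∘ₚ π) λ j →
  subst (λ k → IsIntervalInℤ (SuffixSet (reverse ∘ₚ π) k)) (opposite-involutive j)
    (IsIntervalInℤ-resp (PrefixSet≐SuffixSet-reverse π (opposite j)) (intervals (opposite j)))

NoMiddleLast⇒IsArc : (π : Permutation′ n) → NoMiddleLast π → IsArc π
NoMiddleLast⇒IsArc π noMid j = interval⇒intervalₙ (NoMiddleLast⇒prefixes π noMid j)

reverse-chain : ∀ {π ρ : Permutation′ n} → NoMiddleFirst π →
  Chain NoMiddleFirst π ρ → Chain NoMiddleLast (reverse ∘ₚ ρ) (reverse ∘ₚ π)
reverse-chain = Chain-anti (reverse ∘ₚ_) reverse-anti (λ _ _ π≈ρ → π≈ρ ∘ opposite)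
  -- `NoMiddleLast` of the reversed word unfolds to `NoMiddleFirst` of the word reversed twice.
  λ π → NoMiddleFirst-resp π (reverse ∘ₚ (reverse ∘ₚ π))
    (λ i → cong (π ⟨$⟩ʳ_) (sym (opposite-involutive i)))

-- Unimodal permutations lie on geodesics

Joined : 𝒜 n → 𝒜 n → Set
Joined u v = ∃ λ (p : Walk u v) → Ascending p

-- The reversed word satisfies `NoMiddleFirst`. Reversal is order-reversing, so its chain to
-- `reverse` yields the walk from `e` to `u`, and its chain from `id` the walk from `u` to `w₀`.
prefix-joined : (u : 𝒜 n) → NoMiddleLast (proj₁ u) → Joined e u × Joined u w₀
prefix-joined u@(π , _) noMid =
  walk NoMiddleLast⇒IsArc (Chain-resp (λ i → opposite-involutive i) π″≈π
    (reverse-chain noMid (chain-to-w₀ (reverse ∘ₚ π) noMid))) ,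
  walk NoMiddleLast⇒IsArc (Chain-resp π″≈π (λ _ → refl)
    (reverse-chain NoMiddleFirst-id (chain-from-id (reverse ∘ₚ π) noMid)))
  where
  π″≈π : (reverse ∘ₚ (reverse ∘ₚ π)) ≈ π
  π″≈π i = cong (π ⟨$⟩ʳ_) (opposite-involutive i)

suffix-joined : (u : 𝒜 n) → NoMiddleFirst (proj₁ u) → Joined e u × Joined u w₀
suffix-joined (π , _) noMid =
  walk NoMiddleFirst⇒IsArc (chain-from-id π noMid) ,
  walk NoMiddleFirst⇒IsArc (chain-to-w₀ π noMid)

concat : {u v w : 𝒜 n} (p : Walk u v) (q : Walk v w) → Ascending p → Ascending q →
  ∃ λ (r : Walk u w) → Ascending r × v ∈ r
concat (stop u≈v) (stop v≈w) _ _ =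
  stop (λ k → trans (u≈v k) (v≈w k)) , tt , sym ∘ u≈v
-- The second walk starts at `v`, which equals `u` only up to `≈ᵥ`, so its first edge is transported
-- to `u`.
concat {u = u} {v} (stop u≈v) (step {v = v′} (i , j , i⋖j , eq) q) _ (asc , ascs) =
  step (i , j , i⋖j , λ k → trans (u≈v k) (eq k)) q ,
  (Ascent-respˡ (proj₁ u) (proj₁ v) (proj₁ v′) u≈v asc , ascs) ,
  inj₁ (sym ∘ u≈v)
concat (step u∼u′ p) q (asc , ascs) ascq =
  let (r , ascr , v∈r) = concat p q ascs ascq
  in step u∼u′ r , (asc , ascr) , inj₂ v∈r

joined⇒geodesic : {u v w : 𝒜 n} → Joined u v × Joined v w → LiesInGeodesicBetween u w v
joined⇒geodesic ((p , ascp) , (q , ascq)) =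
  let (r , ascr , v∈r) = concat p q ascp ascq
  in r , Ascending⇒IsGeodesic r ascr , v∈r

unimodal⇒geodesic : (u : 𝒜 n) → IsUnimodal (proj₁ u) → LiesInGeodesicBetween e w₀ u
unimodal⇒geodesic u (inj₁ prefixes) =
  joined⇒geodesic {v = u} (prefix-joined u (prefixes⇒NoMiddleLast (proj₁ u) prefixes))
unimodal⇒geodesic u (inj₂ suffixes) =
  joined⇒geodesic {v = u} (suffix-joined u (suffixes⇒NoMiddleFirst (proj₁ u) suffixes))

-- Permutations on geodesics are unimodal

-- Of four letters in increasing order, an interval of ℤₙ cannot contain the
-- first and the third, or the second and the fourth, and avoid the other two.
record NonCrossing (π : Permutation′ n) : Set where
  field
    odd  : ∀ (j : Fin n) {a b c d} → π ⟨$⟩ʳ a < π ⟨$⟩ʳ b → π ⟨$⟩ʳ b < π ⟨$⟩ʳ c → π ⟨$⟩ʳ c < π ⟨$⟩ʳ d →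
           a ≤ j → c ≤ j → j < b → ¬ j < d
    even : ∀ (j : Fin n) {a b c d} → π ⟨$⟩ʳ a < π ⟨$⟩ʳ b → π ⟨$⟩ʳ b < π ⟨$⟩ʳ c → π ⟨$⟩ʳ c < π ⟨$⟩ʳ d →
           b ≤ j → d ≤ j → j < a → ¬ j < c

open NonCrossing

-- An interval of ℤ contains everything between two of its letters. In a wrap-around interval one
-- part is closed upwards and the other downwards, so a letter of the prefix forces one of its
-- neighbours among the four into it.
IsArc⇒NonCrossing : (π : Permutation′ n) → IsArc π → NonCrossing π
IsArc⇒NonCrossing π arc .odd j {a} {b} {c} {d} a<b b<c c<d a≤j c≤j j<b j<d with arc j
... | x , y , _ , inj₁ (to , from) = ∉PrefixSet π j<b
  (from ( ℕₚ.≤-trans (proj₁ (to (a , a≤j , refl))) (ℕₚ.<⇒≤ a<b)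
        , ℕₚ.≤-trans (ℕₚ.<⇒≤ b<c) (proj₂ (to (c , c≤j , refl)))))
... | x , y , _ , inj₂ (to , from) with to (a , a≤j , refl) | to (c , c≤j , refl)
...   | inj₁ y≤a | _        = ∉PrefixSet π j<b (from (inj₁ (ℕₚ.≤-trans y≤a (ℕₚ.<⇒≤ a<b))))
...   | inj₂ _   | inj₁ y≤c = ∉PrefixSet π j<d (from (inj₁ (ℕₚ.≤-trans y≤c (ℕₚ.<⇒≤ c<d))))
...   | inj₂ _   | inj₂ c≤x = ∉PrefixSet π j<b (from (inj₂ (ℕₚ.≤-trans (ℕₚ.<⇒≤ b<c) c≤x)))
IsArc⇒NonCrossing π arc .even j {a} {b} {c} {d} a<b b<c c<d b≤j d≤j j<a j<c with arc j
... | x , y , _ , inj₁ (to , from) = ∉PrefixSet π j<c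
  (from ( ℕₚ.≤-trans (proj₁ (to (b , b≤j , refl))) (ℕₚ.<⇒≤ b<c)
        , ℕₚ.≤-trans (ℕₚ.<⇒≤ c<d) (proj₂ (to (d , d≤j , refl)))))
... | x , y , _ , inj₂ (to , from) with to (b , b≤j , refl)
...   | inj₁ y≤b = ∉PrefixSet π j<c (from (inj₁ (ℕₚ.≤-trans y≤b (ℕₚ.<⇒≤ b<c))))
...   | inj₂ b≤x = ∉PrefixSet π j<a (from (inj₂ (ℕₚ.≤-trans (ℕₚ.<⇒≤ a<b) b≤x)))

<fromℕ : {i : Fin (suc m)} → i ≢ fromℕ m → i < fromℕ m
<fromℕ {i = i} i≢m = ≤∧≢⇒< {i = i} {fromℕ _} (≤fromℕ i) i≢m

0<′ : {i : Fin (suc m)} → i ≢ zero → zero {m} < i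
0<′ {i = i} i≢0 = ≤∧≢⇒< {i = zero} {i} z≤n (i≢0 ∘ sym)

Extreme : Fin (suc m) → Set
Extreme {m} x = x ≡ zero ⊎ x ≡ fromℕ m

extreme? : Decidable (Extreme {m})
extreme? {m} x = (x ≟ zero) ⊎-dec (x ≟ fromℕ m)

module _ (π : Permutation′ (suc m)) (noncrossing : NonCrossing π) where

  private
    first last : Fin (suc m)
    first = zero
    last  = fromℕ m

  -- The prefix ending at `k` contains the extreme letter and the middle one but neither outer
  -- letter, which is a crossing.
  extremeFirst⇒NoMiddleFirst : Extreme (π ⟨$⟩ʳ first) → NoMiddleFirst π
  extremeFirst⇒NoMiddleFirst extreme k i j k<i k<j πi<πk πk<πj with extreme
  ... | inj₁ π₀≡0 = noncrossing .odd k {first} {i} {k} {j}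
    (subst (_< π ⟨$⟩ʳ i) (sym π₀≡0) (0<′ λ πi≡0 →
      ℕₚ.n≮0 (subst (k <_) (⟨$⟩ʳ-injective π (trans πi≡0 (sym π₀≡0))) k<i)))
    πi<πk πk<πj z≤n ℕₚ.≤-refl k<i k<j
  ... | inj₂ π₀≡m = noncrossing .even k {i} {k} {j} {first} πi<πk πk<πj
    (subst (π ⟨$⟩ʳ j <_) (sym π₀≡m) (<fromℕ λ πj≡m →
      ℕₚ.n≮0 (subst (k <_) (⟨$⟩ʳ-injective π (trans πj≡m (sym π₀≡m))) k<j)))
    ℕₚ.≤-refl z≤n k<i k<j

  extremeLast⇒NoMiddleLast : Extreme (π ⟨$⟩ʳ last) → NoMiddleLast π
  extremeLast⇒NoMiddleLast extreme k i j k<i k<j =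
    crossing (opposite-anti-< {i = k} {i} k<i) (opposite-anti-< {i = k} {j} k<j)
    where
    crossing : ∀ {i j k} → i < k → j < k → π ⟨$⟩ʳ i < π ⟨$⟩ʳ k → ¬ (π ⟨$⟩ʳ k < π ⟨$⟩ʳ j)
    -- The relevant prefix ends at `inject₁ k`, just before the middle letter: it contains both
    -- outer letters but neither the middle one nor the last.
    crossing {i} {j} {suc k} i<k j<k πi<πk πk<πj = case extreme
      where
      ≤k⁻ : ∀ {l : Fin (suc m)} → l < suc k → l ≤ inject₁ k
      ≤k⁻ {l} l<k = subst (toℕ l ℕ.≤_) (sym (toℕ-inject₁ k)) (ℕₚ.≤-pred l<k)
      k⁻<k : inject₁ k < suc k
      k⁻<k = s≤s (ℕₚ.≤-reflexive (toℕ-inject₁ k))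
      k⁻<last : inject₁ k < last
      k⁻<last = subst₂ ℕ._<_ (sym (toℕ-inject₁ k)) (sym (toℕ-fromℕ _)) (toℕ<n k)
      ≢last : ∀ {l x} → l < suc k → π ⟨$⟩ʳ last ≡ x → π ⟨$⟩ʳ l ≢ x
      ≢last l<k eq eq′ with ⟨$⟩ʳ-injective π (trans eq′ (sym eq))
      ... | refl = ℕₚ.<⇒≱ l<k (≤fromℕ (suc k))
      case : ¬ Extreme (π ⟨$⟩ʳ last)
      case (inj₁ πₘ≡0) = noncrossing .even (inject₁ k) {last} {i} {suc k} {j}
        (subst (_< π ⟨$⟩ʳ i) (sym πₘ≡0) (0<′ (≢last i<k πₘ≡0)))
        πi<πk πk<πj (≤k⁻ {i} i<k) (≤k⁻ {j} j<k) k⁻<last k⁻<k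
      case (inj₂ πₘ≡m) = noncrossing .odd (inject₁ k) {i} {suc k} {j} {last} πi<πk πk<πj
        (subst (π ⟨$⟩ʳ j <_) (sym πₘ≡m) (<fromℕ (≢last j<k πₘ≡m)))
        (≤k⁻ {i} i<k) (≤k⁻ {j} j<k) k⁻<k k⁻<last

-- Positions of the letters 1 and n along ascents

Interior : Permutation′ (suc m) → Set
Interior {m} π = ¬ Extreme (π ⟨$⟩ʳ zero) × ¬ Extreme (π ⟨$⟩ʳ fromℕ m)

Interior-≢ : (π : Permutation′ (suc m)) → Interior π → ∀ {i} → Extreme (π ⟨$⟩ʳ i) →
  zero ≢ i × fromℕ m ≢ i
Interior-≢ π (inner₀ , innerₘ) extreme = (λ { refl → inner₀ extreme }) , λ { refl → innerₘ extreme }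

-- Let p and q be the first and the last letter. If p < q, the prefix of ρ
-- ending at i contains p and n but not 1 and q; if q < p, the prefix of π
-- ending at i contains 1 and p but not q and n.
no-extreme-swap : (π ρ : Permutation′ (suc m)) → NonCrossing π → NonCrossing ρ →
  ∀ {i j} → i ⋖ j → Swapped i j (π ⟨$⟩ʳ_) (ρ ⟨$⟩ʳ_) → Interior π →
  π ⟨$⟩ʳ i ≡ zero → π ⟨$⟩ʳ j ≢ fromℕ m
no-extreme-swap {m} π ρ πnc ρnc {i} {j} i⋖j s inner@(inner₀ , innerₘ) πi≡0 πj≡m
  with Interior-≢ π inner {i} (inj₁ πi≡0) | Interior-≢ π inner {j} (inj₂ πj≡m)
     | <-cmp (π ⟨$⟩ʳ zero) (π ⟨$⟩ʳ fromℕ m)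
... | 0≢i , m≢i | 0≢j , m≢j | tri< p<q _ _ = ρnc .even i {j} {zero} {fromℕ m} {i}
  (subst₂ _<_ (sym (trans (s .atʳ) πi≡0)) (sym (s .else 0≢i 0≢j)) (0<′ (inner₀ ∘ inj₁)))
  (subst₂ _<_ (sym (s .else 0≢i 0≢j)) (sym (s .else m≢i m≢j)) p<q)
  (subst₂ _<_ (sym (s .else m≢i m≢j)) (sym (trans (s .atˡ) πj≡m)) (<fromℕ (innerₘ ∘ inj₂)))
  z≤n ℕₚ.≤-refl (⋖⇒< {i = i} {j} i⋖j) (<fromℕ (m≢i ∘ sym))
... | 0≢i , m≢i | _ | tri> _ _ q<p = πnc .odd i {i} {fromℕ m} {zero} {j}
  (subst (_< π ⟨$⟩ʳ fromℕ m) (sym πi≡0) (0<′ (innerₘ ∘ inj₁)))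
  q<p
  (subst (π ⟨$⟩ʳ zero <_) (sym πj≡m) (<fromℕ (inner₀ ∘ inj₂)))
  ℕₚ.≤-refl z≤n (<fromℕ (m≢i ∘ sym)) (⋖⇒< {i = i} {j} i⋖j)
... | 0≢i , _ | _ | tri≈ _ p≡q _ = ℕₚ.n≮0 (subst (toℕ i ℕ.<_)
  (cong toℕ (sym (⟨$⟩ʳ-injective π p≡q))) (<fromℕ λ i≡m →
    0≢i (trans (⟨$⟩ʳ-injective π p≡q) (sym i≡m))))

-- Used with { x , y } = { 1 , n }. Among arc permutations, the interior ones are
-- the non-unimodal ones.
record Stuck (x y : Fin (suc m)) (π : Permutation′ (suc m)) : Set where
  field
    interior : Interior π
    {posˡ posʳ} : Fin (suc m)
    before : posˡ < posʳ
    atPosˡ : π ⟨$⟩ʳ posˡ ≡ x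
    atPosʳ : π ⟨$⟩ʳ posʳ ≡ y

open Stuck

Stuck-resp : {x y : Fin (suc m)} (π ρ : Permutation′ (suc m)) → π ≈ ρ → Stuck x y π → Stuck x y ρ
Stuck-resp _ _ π≈ρ st .interior =
  subst (¬_ ∘ Extreme) (π≈ρ _) (proj₁ (st .interior)) ,
  subst (¬_ ∘ Extreme) (π≈ρ _) (proj₂ (st .interior))
Stuck-resp _ _ π≈ρ st .posˡ   = st .posˡ
Stuck-resp _ _ π≈ρ st .posʳ   = st .posʳ
Stuck-resp _ _ π≈ρ st .before = st .before
Stuck-resp _ _ π≈ρ st .atPosˡ = trans (sym (π≈ρ _)) (st .atPosˡ)
Stuck-resp _ _ π≈ρ st .atPosʳ = trans (sym (π≈ρ _)) (st .atPosʳ)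

-- The hypotheses let `x` move only right and `y` only left, without exchanging them. So only `y`
-- could newly reach the first position, from the second one; but `x` precedes `y` and would already
-- be first. The last position is symmetric.
Stuck-Swapped : {x y : Fin (suc m)} → Extreme x → Extreme y →
  (∀ {z} → Extreme z → z ≡ x ⊎ z ≡ y) →
  (π ρ : Permutation′ (suc m)) {i j : Fin (suc m)} → i ⋖ j →
  Swapped i j (π ⟨$⟩ʳ_) (ρ ⟨$⟩ʳ_) →
  π ⟨$⟩ʳ j ≢ x → π ⟨$⟩ʳ i ≢ y → (π ⟨$⟩ʳ i ≡ x → π ⟨$⟩ʳ j ≢ y) →
  Stuck x y π → Stuck x y ρ
Stuck-Swapped {m} {x} {y} ex ey split π ρ {i} {j} i⋖j s πj≢x πi≢y ¬both st = stuck
  where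
  a b : Fin (suc m)
  a = st .posˡ
  b = st .posʳ

  a<b : a < b
  a<b = st .before

  inner₀ : ¬ Extreme (ρ ⟨$⟩ʳ zero)
  inner₀ extreme with zero ≟ i | zero ≟ j
  ... | no _     | yes refl = contradiction i⋖j λ ()
  ... | no 0≢i   | no 0≢j   = proj₁ (st .interior) (subst Extreme (s .else 0≢i 0≢j) extreme)
  ... | yes refl | _ with split (subst Extreme (s .atˡ) extreme)
  ...   | inj₁ πj≡x = πj≢x πj≡x
  ...   | inj₂ πj≡y with ⟨$⟩ʳ-injective π (trans (st .atPosʳ) (sym πj≡y)) | a ≟ i
  ...     | _   | yes a≡i = proj₁ (st .interior)
    (subst Extreme (sym (trans (cong (π ⟨$⟩ʳ_) (sym a≡i)) (st .atPosˡ))) ex)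
  ...     | b≡j | no a≢i  =
    ℕₚ.n≮0 (<-⋖ {i = i} {j} {a} i⋖j (subst (a <_) b≡j a<b) a≢i)

  innerₘ : ¬ Extreme (ρ ⟨$⟩ʳ fromℕ m)
  innerₘ extreme with fromℕ m ≟ i | fromℕ m ≟ j
  ... | yes refl | _        = ℕₚ.<⇒≱ (⋖⇒< {i = i} {j} i⋖j) (≤fromℕ j)
  ... | no m≢i   | no m≢j   = proj₂ (st .interior) (subst Extreme (s .else m≢i m≢j) extreme)
  ... | no _     | yes refl with split (subst Extreme (s .atʳ) extreme)
  ...   | inj₂ πi≡y = πi≢y πi≡y
  ...   | inj₁ πi≡x with ⟨$⟩ʳ-injective π (trans (st .atPosˡ) (sym πi≡x)) | b ≟ j
  ...     | _   | yes b≡j = proj₂ (st .interior)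
    (subst Extreme (sym (trans (cong (π ⟨$⟩ʳ_) (sym b≡j)) (st .atPosʳ))) ey)
  ...     | a≡i | no b≢j  =
    ℕₚ.<⇒≱ (⋖-< {i = i} {j} {b} i⋖j (subst (_< b) a≡i a<b) b≢j) (≤fromℕ b)

  τ : Fin (suc m) → Fin (suc m)
  τ = PC.transpose i j

  ρτ : ∀ k → ρ ⟨$⟩ʳ τ k ≡ π ⟨$⟩ʳ k
  ρτ k = trans (Swapped⇒transpose s (τ k)) (cong (π ⟨$⟩ʳ_) (transpose-involutive i j k))

  τa<τb : τ a < τ b
  τa<τb with transpose-< {a = a} {b} i⋖j a<b
  ... | inj₂ lt = lt
  ... | inj₁ (a≡i , b≡j) = contradiction
    (trans (cong (π ⟨$⟩ʳ_) (sym b≡j)) (st .atPosʳ))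
    (¬both (trans (cong (π ⟨$⟩ʳ_) (sym a≡i)) (st .atPosˡ)))

  stuck : Stuck x y ρ
  stuck .interior = inner₀ , innerₘ
  stuck .posˡ     = τ a
  stuck .posʳ     = τ b
  stuck .before   = τa<τb
  stuck .atPosˡ   = trans (ρτ a) (st .atPosˡ)
  stuck .atPosʳ   = trans (ρτ b) (st .atPosʳ)

<⇒≢0 : {i j : Fin (suc m)} → i < j → j ≢ zero
<⇒≢0 i<j refl = ℕₚ.n≮0 i<j

<⇒≢fromℕ : {i j : Fin (suc m)} → i < j → i ≢ fromℕ m
<⇒≢fromℕ {j = j} i<j refl = ℕₚ.<⇒≱ i<j (≤fromℕ j)

-- The right letter of an ascent is not 1 and the left one is not n, which gives the restrictions on
-- movement; `no-extreme-swap` excludes the exchange.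
Stuck-up : (u v : 𝒜 (suc m)) → Ascent (proj₁ u) (proj₁ v) →
  Stuck zero (fromℕ m) (proj₁ u) → Stuck zero (fromℕ m) (proj₁ v)
Stuck-up (π , πarc) (ρ , ρarc) (i , j , i⋖j , πi<πj , s) st =
  Stuck-Swapped (inj₁ refl) (inj₂ refl) (λ z → z) π ρ i⋖j s
    (<⇒≢0 {i = π ⟨$⟩ʳ i} πi<πj) (<⇒≢fromℕ {j = π ⟨$⟩ʳ j} πi<πj)
    (no-extreme-swap π ρ (IsArc⇒NonCrossing π πarc) (IsArc⇒NonCrossing ρ ρarc) i⋖j s
      (st .interior))
    st

Stuck-down : (u v : 𝒜 (suc m)) → Ascent (proj₁ u) (proj₁ v) →
  Stuck (fromℕ m) zero (proj₁ v) → Stuck (fromℕ m) zero (proj₁ u)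
Stuck-down {m} (π , πarc) (ρ , ρarc) (i , j , i⋖j , πi<πj , s) st =
  Stuck-Swapped (inj₂ refl) (inj₁ refl) swap ρ π i⋖j (Swapped-sym s)
    (<⇒≢fromℕ {j = π ⟨$⟩ʳ j} πi<πj ∘ trans (sym (s .atʳ)))
    (<⇒≢0 {i = π ⟨$⟩ʳ i} πi<πj ∘ trans (sym (s .atˡ)))
    (λ ρi≡m ρj≡0 →
      let (0≢i , m≢i) = Interior-≢ ρ (st .interior) {i} (inj₂ ρi≡m)
          (0≢j , m≢j) = Interior-≢ ρ (st .interior) {j} (inj₁ ρj≡0)
      -- `no-extreme-swap` speaks of the lower permutation. Both exchanged positions carry extreme
      -- letters, so they are not the end positions, and interiority passes from `ρ` to `π`.
      in no-extreme-swap π ρ (IsArc⇒NonCrossing π πarc) (IsArc⇒NonCrossing ρ ρarc) i⋖j s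
           ( subst (¬_ ∘ Extreme) (s .else 0≢i 0≢j) (proj₁ (st .interior))
           , subst (¬_ ∘ Extreme) (s .else m≢i m≢j) (proj₂ (st .interior)))
           (trans (sym (s .atʳ)) ρj≡0) (trans (sym (s .atˡ)) ρi≡m))
    st

start∈ : {u v : 𝒜 n} (p : Walk u v) → u ∈ p
start∈ (stop _)   = λ _ → refl
start∈ (step _ _) = inj₁ λ _ → refl

Stuck-end : {u v x : 𝒜 (suc m)} (p : Walk u v) → Ascending p → x ∈ p →
  Stuck zero (fromℕ m) (proj₁ x) → Stuck zero (fromℕ m) (proj₁ v)
Stuck-end {u = u} {v} {x} (stop u≈v) _ x≈u st =
  Stuck-resp (proj₁ x) (proj₁ v) (λ k → trans (x≈u k) (u≈v k)) st
Stuck-end {u = u} {x = x} (step {v = v} _ p) (asc , ascs) (inj₁ x≈u) st =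
  -- From here on the tracked vertex is the start of the remaining walk.
  Stuck-end {x = v} p ascs (start∈ p)
    (Stuck-up u v asc (Stuck-resp (proj₁ x) (proj₁ u) x≈u st))
Stuck-end {x = x} (step _ p) (_ , ascs) (inj₂ x∈p) st = Stuck-end {x = x} p ascs x∈p st

Stuck-start : {u v x : 𝒜 (suc m)} (p : Walk u v) → Ascending p → x ∈ p →
  Stuck (fromℕ m) zero (proj₁ x) → Stuck (fromℕ m) zero (proj₁ u)
Stuck-start {u = u} {x = x} (stop _) _ x≈u = Stuck-resp (proj₁ x) (proj₁ u) x≈u
Stuck-start {u = u} {x = x} (step _ _) _ (inj₁ x≈u) = Stuck-resp (proj₁ x) (proj₁ u) x≈u
Stuck-start {u = u} {x = x} (step {v = v} _ p) (asc , ascs) (inj₂ x∈p) st =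
  Stuck-down u v asc (Stuck-start {x = x} p ascs x∈p st)

0≡fromℕ⇒Extreme : zero ≡ fromℕ m → (x : Fin (suc m)) → Extreme x
0≡fromℕ⇒Extreme {zero} _ zero = inj₁ refl

-- The ascending walk used for comparison comes from `e` being unimodal itself.
geodesic-ascending : (p : Walk (e {n}) w₀) → IsGeodesic p → Ascending p
geodesic-ascending p =
  let (q , asc) = proj₂ (suffix-joined e NoMiddleFirst-id) in IsGeodesic⇒Ascending q p asc

geodesic⇒unimodal : (u : 𝒜 n) → LiesInGeodesicBetween e w₀ u → IsUnimodal (proj₁ u)
geodesic⇒unimodal {zero} _ _ = inj₁ λ ()
geodesic⇒unimodal {suc m} u@(π , arc) (p , geodesic , u∈p)
  with extreme? (π ⟨$⟩ʳ zero) | extreme? (π ⟨$⟩ʳ fromℕ m)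
... | yes extreme | _ = inj₂ (NoMiddleFirst⇒suffixes π
  (extremeFirst⇒NoMiddleFirst π (IsArc⇒NonCrossing π arc) extreme))
... | no _ | yes extreme = inj₁ (NoMiddleLast⇒prefixes π
  (extremeLast⇒NoMiddleLast π (IsArc⇒NonCrossing π arc) extreme))
... | no inner₀ | no innerₘ with <-cmp (π ⟨$⟩ˡ zero) (π ⟨$⟩ˡ fromℕ m)
-- 1 precedes n, so `w₀` would be interior, yet its first letter is n.
...   | tri< lt _ _ = contradiction (inj₂ refl) (proj₁ (end .interior))
  where
  end : Stuck zero (fromℕ m) (proj₁ w₀)
  end = Stuck-end {x = u} p (geodesic-ascending p geodesic) u∈p
    (record { interior = inner₀ , innerₘ ; before = lt ; atPosˡ = inverseʳ π ; atPosʳ = inverseʳ π })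
-- Equal positions make 1 and n the same letter, and then every letter is extreme.
...   | tri≈ _ eq _ = contradiction
  (0≡fromℕ⇒Extreme (trans (sym (inverseʳ π)) (trans (cong (π ⟨$⟩ʳ_) eq) (inverseʳ π))) _) inner₀
-- n precedes 1, so `e` would be interior, yet its first letter is 1.
...   | tri> _ _ gt = contradiction (inj₁ refl) (proj₁ (start .interior))
  where
  start : Stuck (fromℕ m) zero (proj₁ e)
  start = Stuck-start {x = u} p (geodesic-ascending p geodesic) u∈p
    (record { interior = inner₀ , innerₘ ; before = gt ; atPosˡ = inverseʳ π ; atPosʳ = inverseʳ π })

lemma6p4 : (n : ℕ) (π : 𝒜 n) →
    LiesInGeodesicBetween e w₀ π ⇔ IsUnimodal (proj₁ π)
lemma6p4 n π = mk⇔ (geodesic⇒unimodal π) (unimodal⇒geodesic π)
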